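{- For every prime $p>2$, $$\sum_{n=0}^{p-1}\frac{(\frac12)_n(\frac12)_{2n}}{n!^3}(20n+3)\frac{(-1)^n}{2^{4n}}\equiv3(-1)^{(p-1)/2}\,p\pmod{p^3};$$ equivalently (using $(\frac12)_{2n}=4^n(\frac14)_n(\frac34)_n$), $$\sum_{n=0}^{p-1}\frac{(\frac12)_n(\frac14)_n(\frac34)_n}{n!^3}(20n+3)\frac{(-1)^n}{2^{2n}}\equiv3(-1)^{(p-1)/2}\,p\pmod{p^3}.$$
   Context: $(a)_n=a(a+1)\cdots(a+n-1)=\Gamma(a+n)/\Gamma(a)$ denotes the Pochhammer symbol, with $(a)_0=1$. The sums are rational numbers with denominators coprime to $p$; congruences are understood in the ring of rationals with denominators coprime to $p$. Note $(-1)^{(p-1)/2}$ equals the Legendre symbol $\bigl(\frac{ -1}{p}\bigr)$. -}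

module Defs where

open import Data.Nat as ℕ using (ℕ; zero; suc)
open import Data.Nat.Combinatorics using ()
open import Data.Nat.Base using (_!)
open import Data.Nat.Properties using (m*n≢0; m^n≢0; _!≢0)
open import Data.Nat.Coprimality using (Coprime)
open import Data.Integer as ℤ using (ℤ; +_)
open import Data.Rational as ℚ using (ℚ; _+_; _*_; _-_; 0ℚ; 1ℚ; _/_)
open import Data.Product using (∃; _×_)
open import Relation.Binary.PropositionalEquality using (_≡_)

_^ℚ_ : ℚ → ℕ → ℚ
q ^ℚ zero = 1ℚ
q ^ℚ suc n = q * (q ^ℚ n)

poch : ℚ → ℕ → ℚ
poch a zero = 1ℚ
poch a (suc n) = poch a n * (a + (+ n / 1))

sumTo : ℕ → (ℕ → ℚ) → ℚ
sumTo zero f = 0ℚ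
sumTo (suc N) f = sumTo N f + f N

ℕ→ℚ : ℕ → ℚ
ℕ→ℚ n = + n / 1

-- a ≡ b (mod m) in the ring of rationals with denominator coprime to p:
-- a - b = m * c for some rational c whose (reduced) denominator is coprime to p
CongMod : ℕ → ℚ → ℚ → ℚ → Set
CongMod p m a b = ∃ λ (c : ℚ) → (a - b ≡ m * c) × Coprime (ℚ.denominatorℕ c) p

half : ℚ
half = + 1 / 2

term : ℕ → ℚ
term n = poch half n * poch half (2 ℕ.* n) * ℕ→ℚ (20 ℕ.* n ℕ.+ 3) * (ℚ.- 1ℚ) ^ℚ n
         * ((+ 1) / (((n !) ℕ.^ 3) ℕ.* (2 ℕ.^ (4 ℕ.* n))))
             {{m*n≢0 ((n !) ℕ.^ 3) (2 ℕ.^ (4 ℕ.* n)) {{m^n≢0 (n !) 3 {{n !≢0}}}} {{m^n≢0 2 (4 ℕ.* n)}}}}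

{-# OPTIONS --safe #-}

-- The proof uses the WZ pair
--   F(n,k) = (−1)^(n+k) (20n − 2k + 3) (½)_n (½)_{2n+k} / (16^n n!² (n−k)! (½)_k²),
--   G(n,k) = −32 n² (n − k) / (k + ½)² · F(n,k) / (20n − 2k + 3),
-- with F(n,k) − F(n,k+1) = G(n+1,k) − G(n,k); the summand of the theorem is F(n,0).  Write
-- p = 2m + 1.  Summing over n < p, and using p³ ∣ G(p,k) for k < m, replaces F(n,0) by F(n,m)
-- modulo p³.  There only n = m survives: F(n,m) = 0 for n < m, while for n > m the factor p/2
-- divides (½)_n and both p/2 and 3p/2 divide (½)_{2n+m}.  Finally
-- F(m,m) = 3p · ∏_{j<m} (p² − (j + ½)²) / (16^m m!²), and modulo p² both this product and
-- (2m)! = ∏_{j<m} ((p/2)² − (j + ½)²) = 4^m m! (½)_m equal (−1)^m (½)_m²; hence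
-- (½)_m ≡ (−4)^m m! and F(m,m) ≡ 3 (−1)^m p modulo p³.

module Submission where

open import Defs
open import Data.Integer.Base as ℤ using (+_)
import Data.Integer.Properties as ℤ
open import Data.Integer.Tactic.RingSolver using () renaming (solve-∀ to ℤ-solve-∀)
open import Data.Nat.Base as ℕ using (ℕ; zero; suc; _!; _>_; _∸_; ⌊_/2⌋)
open import Data.Nat.Properties as ℕ using (_!≢0)
open import Data.Nat.Coprimality as Coprimality using (Coprime; coprime-divisor; prime⇒coprime; 1-coprimeTo)
open import Data.Nat.Divisibility using (_∣_; divides; ∣-trans; m∣m*n)
open import Data.Nat.Primality using (Prime; prime⇒irreducible)
open import Data.Nat.Tactic.RingSolver using () renaming (solve-∀ to ℕ-solve-∀)
open import Data.Product using (∃; _,_)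
open import Data.Sum using (_⊎_; inj₁; inj₂)
open import Data.Rational.Base as ℚ hiding (_>_)
open import Data.Rational.Properties
open import Data.Rational.Unnormalised.Base as ℚᵘ using (mkℚᵘ; *≡*)
import Data.Rational.Unnormalised.Properties as ℚᵘ
open import Relation.Binary.PropositionalEquality
open import Relation.Nullary using (contradiction)
open import Relation.Nullary.Decidable using (dec⇒maybe)
open import Tactic.RingSolver using (solve-∀)
open import Tactic.RingSolver.Core.AlmostCommutativeRing using (AlmostCommutativeRing; fromCommutativeRing)
open import Level using (0ℓ)

-- Rational arithmetic and the embedding of the naturals.

ring : AlmostCommutativeRing 0ℓ 0ℓ
ring = fromCommutativeRing +-*-commutativeRing (λ x → dec⇒maybe (0ℚ ≟ x))

-- `i / suc n` is `fromℚᵘ (mkℚᵘ i n)`, so once `fromℚᵘ` respects sums and products, fractions can be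
-- combined without meeting their reduced forms. It inherits this from its inverse `toℚᵘ`.
fromℚᵘ-homo-+ : ∀ x y → fromℚᵘ (x ℚᵘ.+ y) ≡ fromℚᵘ x + fromℚᵘ y
fromℚᵘ-homo-+ x y = toℚᵘ-injective (ℚᵘ.≃-trans (toℚᵘ-fromℚᵘ (x ℚᵘ.+ y)) (ℚᵘ.≃-sym
  (ℚᵘ.≃-trans (toℚᵘ-homo-+ (fromℚᵘ x) (fromℚᵘ y)) (ℚᵘ.+-cong (toℚᵘ-fromℚᵘ x) (toℚᵘ-fromℚᵘ y)))))

fromℚᵘ-homo-* : ∀ x y → fromℚᵘ (x ℚᵘ.* y) ≡ fromℚᵘ x * fromℚᵘ y
fromℚᵘ-homo-* x y = toℚᵘ-injective (ℚᵘ.≃-trans (toℚᵘ-fromℚᵘ (x ℚᵘ.* y)) (ℚᵘ.≃-sym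
  (ℚᵘ.≃-trans (toℚᵘ-homo-* (fromℚᵘ x) (fromℚᵘ y)) (ℚᵘ.*-cong (toℚᵘ-fromℚᵘ x) (toℚᵘ-fromℚᵘ y)))))

ℕ→ℚ-+ : ∀ m n → ℕ→ℚ (m ℕ.+ n) ≡ ℕ→ℚ m + ℕ→ℚ n
ℕ→ℚ-+ m n = trans
  (fromℚᵘ-cong {mkℚᵘ (+ (m ℕ.+ n)) 0} {mkℚᵘ (+ m) 0 ℚᵘ.+ mkℚᵘ (+ n) 0} (*≡* (cross (+ m) (+ n))))
  (fromℚᵘ-homo-+ (mkℚᵘ (+ m) 0) (mkℚᵘ (+ n) 0))
  where
  cross : ∀ i j → (i ℤ.+ j) ℤ.* (+ 1 ℤ.* + 1) ≡ (i ℤ.* + 1 ℤ.+ j ℤ.* + 1) ℤ.* + 1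
  cross = ℤ-solve-∀

/-*-/ : ∀ i j m n .{{_ : ℕ.NonZero m}} .{{_ : ℕ.NonZero n}} .{{_ : ℕ.NonZero (m ℕ.* n)}} →
        (i ℤ.* j) / (m ℕ.* n) ≡ (i / m) * (j / n)
/-*-/ i j (suc m) (suc n) = fromℚᵘ-homo-* (mkℚᵘ i m) (mkℚᵘ j n)

ℕ→ℚ-* : ∀ m n → ℕ→ℚ (m ℕ.* n) ≡ ℕ→ℚ m * ℕ→ℚ n
ℕ→ℚ-* m n = trans (cong (_/ 1) (ℤ.pos-* m n)) (/-*-/ (+ m) (+ n) 1 1)

/-inverse : ∀ n .{{_ : ℕ.NonZero n}} → (+ 1 / n) * ℕ→ℚ n ≡ 1ℚ
/-inverse n@(suc n-1) = trans (sym (/-*-/ (+ 1) (+ n) n 1))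
  (fromℚᵘ-cong {mkℚᵘ (+ 1 ℤ.* + n) (n-1 ℕ.* 1)} {mkℚᵘ (+ 1) 0} (*≡* (cross (+ n))))
  where
  cross : ∀ i → (+ 1 ℤ.* i) ℤ.* + 1 ≡ + 1 ℤ.* (i ℤ.* + 1)
  cross = ℤ-solve-∀


-- Building blocks of the WZ pair.

-1^_ : ℕ → ℚ
-1^ n = (- 1ℚ) ^ℚ n

recip : ℕ → ℚ
recip n = + 1 / suc n

-- 1/n! as a running product of unit fractions: its recurrence is definitional, and its
-- p-integrality can be checked factor by factor. `invPoch` treats 1/(½)_k the same way.
invFact : ℕ → ℚ
invFact zero = 1ℚ
invFact (suc n) = invFact n * recip n

-- 1/(k + ½), with an integer denominator
invOdd : ℕ → ℚ
invOdd k = ℕ→ℚ 2 * recip (2 ℕ.* k)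

invPoch : ℕ → ℚ
invPoch zero = 1ℚ
invPoch (suc k) = invPoch k * invOdd k

falling : ℚ → ℕ → ℚ
falling x zero = 1ℚ
falling x (suc k) = falling x k * (x - ℕ→ℚ k)

1/16 : ℚ
1/16 = + 1 / 16

P : ℕ → ℚ
P = poch half

cube : ℚ → ℚ
cube x = x * x * x

-- falling n k / n! plays the role of 1/(n − k)!, which makes T n k vanish for n < k.
T : ℕ → ℕ → ℚ
T n k = (-1^ n * P n * 1/16 ^ℚ n * cube (invFact n)) * (-1^ k * (invPoch k * invPoch k))
        * P (2 ℕ.* n ℕ.+ k) * falling (ℕ→ℚ n) k

F : ℕ → ℕ → ℚ
F n k = (ℕ→ℚ 20 * ℕ→ℚ n - ℕ→ℚ 2 * ℕ→ℚ k + ℕ→ℚ 3) * T n k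

-- Written with `T`, the hypergeometric part that it shares with `F`, so that nothing has to be
-- divided by 20n - 2k + 3.
G : ℕ → ℕ → ℚ
G n k = - (ℕ→ℚ 32 * (ℕ→ℚ n * ℕ→ℚ n) * (ℕ→ℚ n - ℕ→ℚ k) * (invOdd k * invOdd k) * T n k)

-- Recurrences for `T` and the WZ identity.

ℕ→ℚ-suc : ∀ n → ℕ→ℚ (suc n) ≡ ℕ→ℚ n + 1ℚ
ℕ→ℚ-suc n = trans (ℕ→ℚ-+ 1 n) (+-comm 1ℚ (ℕ→ℚ n))

ℕ→ℚ-double : ∀ n → ℕ→ℚ (2 ℕ.* n) ≡ ℕ→ℚ 2 * ℕ→ℚ n
ℕ→ℚ-double = ℕ→ℚ-* 2

recip-inverse : ∀ n → recip n * (ℕ→ℚ n + 1ℚ) ≡ 1ℚ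
recip-inverse n = trans (cong (recip n *_) (sym (ℕ→ℚ-suc n))) (/-inverse (suc n))

invOdd-inverse : ∀ k → invOdd k * (ℕ→ℚ k + half) ≡ 1ℚ
invOdd-inverse k = begin
  invOdd k * (ℕ→ℚ k + half)                  ≡⟨ regroup (recip (2 ℕ.* k)) (ℕ→ℚ k) ⟩
  recip (2 ℕ.* k) * (ℕ→ℚ 2 * ℕ→ℚ k + 1ℚ)     ≡⟨ cong (λ z → recip (2 ℕ.* k) * (z + 1ℚ)) (ℕ→ℚ-double k) ⟨
  recip (2 ℕ.* k) * (ℕ→ℚ (2 ℕ.* k) + 1ℚ)     ≡⟨ recip-inverse (2 ℕ.* k) ⟩
  1ℚ                                         ∎
  where
  open ≡-Reasoning
  regroup : ∀ r x → ℕ→ℚ 2 * r * (x + half) ≡ r * (ℕ→ℚ 2 * x + 1ℚ)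
  regroup = solve-∀ ring

-- The definition appends factors at the small end; peeling one off at the large end is what relates
-- n + 1 to n.
falling-suc : ∀ x k → falling (x + 1ℚ) (suc k) ≡ (x + 1ℚ) * falling x k
falling-suc x zero = base x
  where
  base : ∀ x → 1ℚ * (x + 1ℚ - ℕ→ℚ 0) ≡ (x + 1ℚ) * 1ℚ
  base = solve-∀ ring
falling-suc x (suc k) = begin
  falling (x + 1ℚ) (suc k) * (x + 1ℚ - ℕ→ℚ (suc k))
    ≡⟨ cong₂ (λ u v → u * (x + 1ℚ - v)) (falling-suc x k) (ℕ→ℚ-suc k) ⟩
  (x + 1ℚ) * falling x k * (x + 1ℚ - (ℕ→ℚ k + 1ℚ))
    ≡⟨ regroup x (falling x k) (ℕ→ℚ k) ⟩
  (x + 1ℚ) * (falling x k * (x - ℕ→ℚ k)) ∎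
  where
  open ≡-Reasoning
  regroup : ∀ x f y → (x + 1ℚ) * f * (x + 1ℚ - (y + 1ℚ)) ≡ (x + 1ℚ) * (f * (x - y))
  regroup = solve-∀ ring

ℕ→ℚ-2n+k : ∀ n k → ℕ→ℚ (2 ℕ.* n ℕ.+ k) ≡ ℕ→ℚ 2 * ℕ→ℚ n + ℕ→ℚ k
ℕ→ℚ-2n+k n k = trans (ℕ→ℚ-+ (2 ℕ.* n) k) (cong (_+ ℕ→ℚ k) (ℕ→ℚ-double n))

T-sucʳ : ∀ n k → T n (suc k) ≡
  - (T n k * (half + (ℕ→ℚ 2 * ℕ→ℚ n + ℕ→ℚ k)) * (ℕ→ℚ n - ℕ→ℚ k) * (invOdd k * invOdd k))
T-sucʳ n k = begin
  T n (suc k)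
    ≡⟨ cong (λ z → a * (-1^ suc k * (q * r * (q * r))) * P z * (f * (x - y))) (ℕ.+-suc (2 ℕ.* n) k) ⟩
  a * (-1^ suc k * (q * r * (q * r))) * (w * (half + ℕ→ℚ (2 ℕ.* n ℕ.+ k))) * (f * (x - y))
    ≡⟨ cong (λ z → a * (-1^ suc k * (q * r * (q * r))) * (w * (half + z)) * (f * (x - y))) (ℕ→ℚ-2n+k n k) ⟩
  a * (- 1ℚ * s * (q * r * (q * r))) * (w * (half + (ℕ→ℚ 2 * x + y))) * (f * (x - y))
    ≡⟨ regroup a s q r w f x y ⟩
  - (T n k * (half + (ℕ→ℚ 2 * x + y)) * (x - y) * (r * r)) ∎
  where
  open ≡-Reasoning
  a = -1^ n * P n * 1/16 ^ℚ n * cube (invFact n)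
  s = -1^ k
  q = invPoch k
  r = invOdd k
  w = P (2 ℕ.* n ℕ.+ k)
  f = falling (ℕ→ℚ n) k
  x = ℕ→ℚ n
  y = ℕ→ℚ k
  regroup : ∀ a s q r w f x y →
    a * (- 1ℚ * s * (q * r * (q * r))) * (w * (half + (ℕ→ℚ 2 * x + y))) * (f * (x - y))
    ≡ - (a * (s * (q * q)) * w * f * (half + (ℕ→ℚ 2 * x + y)) * (x - y) * (r * r))
  regroup = solve-∀ ring

-- The factor n + 1 − k, which falling (n + 1) k lacks, keeps the recurrence free of division.
T-sucˡ : ∀ n k → (ℕ→ℚ n + 1ℚ) * (ℕ→ℚ n + 1ℚ) * (ℕ→ℚ n + 1ℚ - ℕ→ℚ k) * T (suc n) k ≡
  - (1/16 * T n k * (half + ℕ→ℚ n) * (half + (ℕ→ℚ 2 * ℕ→ℚ n + ℕ→ℚ k)) * (half + (ℕ→ℚ 2 * ℕ→ℚ n + ℕ→ℚ k + 1ℚ)))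
T-sucˡ n k = begin
  (x + 1ℚ) * (x + 1ℚ) * (x + 1ℚ - y) * T (suc n) k
    ≡⟨ cong₂ (λ u v → (x + 1ℚ) * (x + 1ℚ) * (x + 1ℚ - y) * (a * b * P u * falling v k)) index (ℕ→ℚ-suc n) ⟩
  (x + 1ℚ) * (x + 1ℚ) * (x + 1ℚ - y) * (a * b * (w * (half + ℕ→ℚ N) * (half + ℕ→ℚ (suc N))) * falling (x + 1ℚ) k)
    ≡⟨ cong₂ (λ u v → (x + 1ℚ) * (x + 1ℚ) * (x + 1ℚ - y) * (a * b * (w * (half + u) * (half + v)) * falling (x + 1ℚ) k))
         (ℕ→ℚ-2n+k n k) (trans (ℕ→ℚ-suc N) (cong (_+ 1ℚ) (ℕ→ℚ-2n+k n k))) ⟩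
  (x + 1ℚ) * (x + 1ℚ) * (x + 1ℚ - y) * (a * b * (w * (half + z) * (half + (z + 1ℚ))) * falling (x + 1ℚ) k)
    ≡⟨ regroup₁ (x + 1ℚ) y a (falling (x + 1ℚ) k) b (w * (half + z) * (half + (z + 1ℚ))) ⟩
  (x + 1ℚ) * (x + 1ℚ) * a * (b * (w * (half + z) * (half + (z + 1ℚ)))) * falling (x + 1ℚ) (suc k)
    ≡⟨ cong (λ u → (x + 1ℚ) * (x + 1ℚ) * a * (b * (w * (half + z) * (half + (z + 1ℚ)))) * u) (falling-suc x k) ⟩
  (x + 1ℚ) * (x + 1ℚ) * a * (b * (w * (half + z) * (half + (z + 1ℚ)))) * ((x + 1ℚ) * f)
    ≡⟨ regroup₂ (-1^ n) (P n) (1/16 ^ℚ n) i r x b w z f ⟩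
  - (1/16 * T n k * (half + x) * (half + z) * (half + (z + 1ℚ))) * cube (r * (x + 1ℚ))
    ≡⟨ cong (λ u → - (1/16 * T n k * (half + x) * (half + z) * (half + (z + 1ℚ))) * cube u) (recip-inverse n) ⟩
  - (1/16 * T n k * (half + x) * (half + z) * (half + (z + 1ℚ))) * 1ℚ
    ≡⟨ *-identityʳ _ ⟩
  - (1/16 * T n k * (half + x) * (half + z) * (half + (z + 1ℚ))) ∎
  where
  open ≡-Reasoning
  N = 2 ℕ.* n ℕ.+ k
  x = ℕ→ℚ n
  y = ℕ→ℚ k
  z = ℕ→ℚ 2 * x + y
  i = invFact n
  r = recip n
  w = P N
  f = falling x k
  a = -1^ suc n * P (suc n) * 1/16 ^ℚ suc n * cube (invFact (suc n))
  b = -1^ k * (invPoch k * invPoch k)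
  index : 2 ℕ.* suc n ℕ.+ k ≡ suc (suc N)
  index = cong (ℕ._+ k) (ℕ.*-suc 2 n)
  regroup₁ : ∀ x′ y a f b w → x′ * x′ * (x′ - y) * (a * b * w * f) ≡ x′ * x′ * a * (b * w) * (f * (x′ - y))
  regroup₁ = solve-∀ ring
  regroup₂ : ∀ s p e i r x b w z f →
    (x + 1ℚ) * (x + 1ℚ) * (- 1ℚ * s * (p * (half + x)) * (1/16 * e) * (i * r * (i * r) * (i * r)))
      * (b * (w * (half + z) * (half + (z + 1ℚ)))) * ((x + 1ℚ) * f)
    ≡ - (1/16 * (s * p * e * (i * i * i) * b * w * f) * (half + x) * (half + z) * (half + (z + 1ℚ)))
      * (r * (x + 1ℚ) * (r * (x + 1ℚ)) * (r * (x + 1ℚ)))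
  regroup₂ = solve-∀ ring

*-square-of-one : ∀ a {u} → u ≡ 1ℚ → a ≡ a * (u * u)
*-square-of-one a refl = sym (*-identityʳ a)

-- Both sides are multiples of `T n k`: `T-sucʳ` rewrites `F n (suc k)`, and the factor (n + 1)² (n
-- + 1 - k) of `G (suc n) k` is exactly the multiplier that `T-sucˡ` needs. A polynomial identity in
-- n, k and 1/(k + ½) remains.
wz-pair : ∀ n k → F n k - F n (suc k) ≡ G (suc n) k - G n k
wz-pair n k = begin
  F n k - F n (suc k)
    ≡⟨ cong₂ (λ u v → F n k - (ℕ→ℚ 20 * x - ℕ→ℚ 2 * u + ℕ→ℚ 3) * v) (ℕ→ℚ-suc k) (T-sucʳ n k) ⟩
  (ℕ→ℚ 20 * x - ℕ→ℚ 2 * y + ℕ→ℚ 3) * t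
    - (ℕ→ℚ 20 * x - ℕ→ℚ 2 * (y + 1ℚ) + ℕ→ℚ 3) * - (t * (half + (ℕ→ℚ 2 * x + y)) * (x - y) * (r * r))
    -- Every other term carries r² = 1/(k + ½)². Multiplying this one by (r (k + ½))² = 1 gives it
    -- the same factor, after which the identity holds for an indeterminate r and the ring solver
    -- can decide it.
    ≡⟨ cong (_- (ℕ→ℚ 20 * x - ℕ→ℚ 2 * (y + 1ℚ) + ℕ→ℚ 3) * - (t * (half + (ℕ→ℚ 2 * x + y)) * (x - y) * (r * r)))
         (*-square-of-one ((ℕ→ℚ 20 * x - ℕ→ℚ 2 * y + ℕ→ℚ 3) * t) (invOdd-inverse k)) ⟩
  (ℕ→ℚ 20 * x - ℕ→ℚ 2 * y + ℕ→ℚ 3) * t * (r * (y + half) * (r * (y + half)))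
    - (ℕ→ℚ 20 * x - ℕ→ℚ 2 * (y + 1ℚ) + ℕ→ℚ 3) * - (t * (half + (ℕ→ℚ 2 * x + y)) * (x - y) * (r * r))
    ≡⟨ certificate x y t r ⟩
  - (ℕ→ℚ 32 * (r * r) * - (1/16 * t * (half + x) * (half + (ℕ→ℚ 2 * x + y)) * (half + (ℕ→ℚ 2 * x + y + 1ℚ)))) - G n k
    ≡⟨ cong (λ u → - (ℕ→ℚ 32 * (r * r) * u) - G n k) (T-sucˡ n k) ⟨
  - (ℕ→ℚ 32 * (r * r) * ((x + 1ℚ) * (x + 1ℚ) * (x + 1ℚ - y) * T (suc n) k)) - G n k
    ≡⟨ cong (_- G n k) (regroup (x + 1ℚ) y r (T (suc n) k)) ⟩
  - (ℕ→ℚ 32 * ((x + 1ℚ) * (x + 1ℚ)) * ((x + 1ℚ) - y) * (r * r) * T (suc n) k) - G n k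
    ≡⟨ cong (λ u → - (ℕ→ℚ 32 * (u * u) * (u - y) * (r * r) * T (suc n) k) - G n k) (ℕ→ℚ-suc n) ⟨
  G (suc n) k - G n k ∎
  where
  open ≡-Reasoning
  x = ℕ→ℚ n
  y = ℕ→ℚ k
  t = T n k
  r = invOdd k
  certificate : ∀ x y t r →
    (ℕ→ℚ 20 * x - ℕ→ℚ 2 * y + ℕ→ℚ 3) * t * (r * (y + half) * (r * (y + half)))
      - (ℕ→ℚ 20 * x - ℕ→ℚ 2 * (y + 1ℚ) + ℕ→ℚ 3) * - (t * (half + (ℕ→ℚ 2 * x + y)) * (x - y) * (r * r))
    ≡ - (ℕ→ℚ 32 * (r * r) * - (1/16 * t * (half + x) * (half + (ℕ→ℚ 2 * x + y)) * (half + (ℕ→ℚ 2 * x + y + 1ℚ))))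
      - - (ℕ→ℚ 32 * (x * x) * (x - y) * (r * r) * t)
  certificate = solve-∀ ring
  regroup : ∀ x′ y r u → - (ℕ→ℚ 32 * (r * r) * (x′ * x′ * (x′ - y) * u)) ≡ - (ℕ→ℚ 32 * (x′ * x′) * (x′ - y) * (r * r) * u)
  regroup = solve-∀ ring

-- Summation over n, and the summand as `F n 0`.

sumTo-cong : ∀ N {f g : ℕ → ℚ} → (∀ n → f n ≡ g n) → sumTo N f ≡ sumTo N g
sumTo-cong zero f≡g = refl
sumTo-cong (suc N) f≡g = cong₂ _+_ (sumTo-cong N f≡g) (f≡g N)

-- The right side of `wz-pair` telescopes in n, and the lower boundary term `G 0 k` vanishes through
-- its factor n².
sum-F-step : ∀ N k → sumTo N (λ n → F n k) - sumTo N (λ n → F n (suc k)) ≡ G N k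
sum-F-step zero k = base (- ℕ→ℚ k) (invOdd k * invOdd k) (T 0 k)
  where
  base : ∀ y r t → 0ℚ - 0ℚ ≡ - (ℕ→ℚ 32 * (ℕ→ℚ 0 * ℕ→ℚ 0) * (ℕ→ℚ 0 + y) * r * t)
  base = solve-∀ ring
sum-F-step (suc N) k = begin
  (s + F N k) - (s′ + F N (suc k))    ≡⟨ regroup s (F N k) s′ (F N (suc k)) ⟩
  (s - s′) + (F N k - F N (suc k))    ≡⟨ cong₂ _+_ (sum-F-step N k) (wz-pair N k) ⟩
  G N k + (G (suc N) k - G N k)       ≡⟨ cancel (G N k) (G (suc N) k) ⟩
  G (suc N) k                         ∎
  where
  open ≡-Reasoning
  s s′ : ℚ
  s = sumTo N (λ n → F n k)
  s′ = sumTo N (λ n → F n (suc k))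
  regroup : ∀ a b c d → (a + b) - (c + d) ≡ (a - c) + (b - d)
  regroup = solve-∀ ring
  cancel : ∀ a b → a + (b - a) ≡ b
  cancel = solve-∀ ring

invFact-correct : ∀ n .{{_ : ℕ.NonZero (n !)}} → + 1 / (n !) ≡ invFact n
invFact-correct zero = refl
invFact-correct (suc n) = begin
  + 1 / (suc n ℕ.* n !)      ≡⟨ /-*-/ (+ 1) (+ 1) (suc n) (n !) ⟩
  recip n * (+ 1 / (n !))    ≡⟨ cong (recip n *_) (invFact-correct n) ⟩
  recip n * invFact n        ≡⟨ *-comm (recip n) (invFact n) ⟩
  invFact n * recip n        ∎
  where
  open ≡-Reasoning
  instance _ = n !≢0

half-power : ∀ n .{{_ : ℕ.NonZero (2 ℕ.^ n)}} → + 1 / (2 ℕ.^ n) ≡ half ^ℚ n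
half-power zero = refl
half-power (suc n) = trans (/-*-/ (+ 1) (+ 1) 2 (2 ℕ.^ n)) (cong (half *_) (half-power n))
  where instance _ = ℕ.m^n≢0 2 n

half-power-4 : ∀ n → half ^ℚ (4 ℕ.* n) ≡ 1/16 ^ℚ n
half-power-4 zero = refl
half-power-4 (suc n) = begin
  half ^ℚ (4 ℕ.* suc n)                             ≡⟨ cong (half ^ℚ_) (ℕ.*-suc 4 n) ⟩
  half * (half * (half * (half * half ^ℚ (4 ℕ.* n))))   ≡⟨ regroup (half ^ℚ (4 ℕ.* n)) ⟩
  1/16 * half ^ℚ (4 ℕ.* n)                          ≡⟨ cong (1/16 *_) (half-power-4 n) ⟩
  1/16 * 1/16 ^ℚ n                                  ∎
  where
  open ≡-Reasoning
  regroup : ∀ x → half * (half * (half * (half * x))) ≡ 1/16 * x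
  regroup = solve-∀ ring

cube-recip : ∀ n .{{_ : ℕ.NonZero n}} .{{_ : ℕ.NonZero (n ℕ.^ 3)}} → + 1 / (n ℕ.^ 3) ≡ cube (+ 1 / n)
cube-recip n = begin
  + 1 / (n ℕ.^ 3)                                 ≡⟨ /-*-/ (+ 1) (+ 1) n (n ℕ.^ 2) ⟩
  + 1 / n * (+ 1 / (n ℕ.^ 2))                     ≡⟨ cong (+ 1 / n *_) (/-*-/ (+ 1) (+ 1) n (n ℕ.^ 1)) ⟩
  + 1 / n * (+ 1 / n * (+ 1 / (n ℕ.^ 1)))         ≡⟨ cong (λ z → + 1 / n * (+ 1 / n * z)) (/-*-/ (+ 1) (+ 1) n 1) ⟩
  + 1 / n * (+ 1 / n * (+ 1 / n * 1ℚ))            ≡⟨ regroup (+ 1 / n) ⟩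
  cube (+ 1 / n)                                  ∎
  where
  open ≡-Reasoning
  instance
    _ = ℕ.m^n≢0 n 2
    _ = ℕ.m^n≢0 n 1
  regroup : ∀ x → x * (x * (x * 1ℚ)) ≡ x * x * x
  regroup = solve-∀ ring

-- At k = 0 every k-dependent factor of `T` is 1; the work lies in breaking the single fraction
-- 1/(n!³ 2^(4n)) into `cube (invFact n)` and a power of 1/16.
term≡F : ∀ n → term n ≡ F n 0
term≡F n = begin
  term n
    ≡⟨ cong₂ (λ u v → P n * P (2 ℕ.* n) * u * -1^ n * v) coefficient denominator ⟩
  P n * P (2 ℕ.* n) * (ℕ→ℚ 20 * x + ℕ→ℚ 3) * -1^ n * (cube i * e)
    ≡⟨ regroup x (P n) (P (2 ℕ.* n)) (-1^ n) i e ⟩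
  (ℕ→ℚ 20 * x - ℕ→ℚ 2 * ℕ→ℚ 0 + ℕ→ℚ 3) * ((-1^ n * P n * e * cube i) * (1ℚ * (1ℚ * 1ℚ)) * P (2 ℕ.* n) * 1ℚ)
    ≡⟨ cong (λ z → (ℕ→ℚ 20 * x - ℕ→ℚ 2 * ℕ→ℚ 0 + ℕ→ℚ 3)
               * ((-1^ n * P n * e * cube i) * (1ℚ * (1ℚ * 1ℚ)) * P z * 1ℚ)) (ℕ.+-identityʳ (2 ℕ.* n)) ⟨
  F n 0 ∎
  where
  open ≡-Reasoning
  x = ℕ→ℚ n
  i = invFact n
  e = 1/16 ^ℚ n
  instance
    _ = n !≢0
    _ = ℕ.m^n≢0 (n !) 3
    _ = ℕ.m^n≢0 2 (4 ℕ.* n)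
    _ = ℕ.m*n≢0 ((n !) ℕ.^ 3) (2 ℕ.^ (4 ℕ.* n))
  coefficient : ℕ→ℚ (20 ℕ.* n ℕ.+ 3) ≡ ℕ→ℚ 20 * x + ℕ→ℚ 3
  coefficient = trans (ℕ→ℚ-+ (20 ℕ.* n) 3) (cong (_+ ℕ→ℚ 3) (ℕ→ℚ-* 20 n))
  denominator : + 1 / ((n !) ℕ.^ 3 ℕ.* 2 ℕ.^ (4 ℕ.* n)) ≡ cube i * e
  denominator = begin
    + 1 / ((n !) ℕ.^ 3 ℕ.* 2 ℕ.^ (4 ℕ.* n))             ≡⟨ /-*-/ (+ 1) (+ 1) ((n !) ℕ.^ 3) (2 ℕ.^ (4 ℕ.* n)) ⟩
    + 1 / ((n !) ℕ.^ 3) * (+ 1 / (2 ℕ.^ (4 ℕ.* n)))     ≡⟨ cong₂ _*_ (cube-recip (n !)) (half-power (4 ℕ.* n)) ⟩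
    cube (+ 1 / (n !)) * half ^ℚ (4 ℕ.* n)              ≡⟨ cong₂ (λ u v → cube u * v) (invFact-correct n) (half-power-4 n) ⟩
    cube i * e                                          ∎
  regroup : ∀ x p p₂ s i e →
    p * p₂ * (ℕ→ℚ 20 * x + ℕ→ℚ 3) * s * (i * i * i * e)
    ≡ (ℕ→ℚ 20 * x - ℕ→ℚ 2 * ℕ→ℚ 0 + ℕ→ℚ 3) * ((s * p * e * (i * i * i)) * (1ℚ * (1ℚ * 1ℚ)) * p₂ * 1ℚ)
  regroup = solve-∀ ring

-- A common divisor `d` of `a * b` and `c` is coprime to `a`, because its divisors divide `c`; hence
-- it divides `b`.
coprime-* : ∀ {a b c} → Coprime a c → Coprime b c → Coprime (a ℕ.* b) c
coprime-* a⊥c b⊥c {d} (d∣ab , d∣c) =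
  b⊥c (coprime-divisor (λ (e∣d , e∣a) → a⊥c (e∣a , ∣-trans e∣d d∣c)) d∣ab , d∣c)

-- Pochhammer identities and the value on the diagonal.

poch-+ : ∀ a m n → poch a (m ℕ.+ n) ≡ poch a m * poch (a + ℕ→ℚ m) n
poch-+ a m zero = trans (cong (poch a) (ℕ.+-identityʳ m)) (sym (*-identityʳ (poch a m)))
poch-+ a m (suc n) = begin
  poch a (m ℕ.+ suc n)                                                ≡⟨ cong (poch a) (ℕ.+-suc m n) ⟩
  poch a (m ℕ.+ n) * (a + ℕ→ℚ (m ℕ.+ n))                              ≡⟨ cong₂ (λ u v → u * (a + v)) (poch-+ a m n) (ℕ→ℚ-+ m n) ⟩
  poch a m * poch (a + ℕ→ℚ m) n * (a + (ℕ→ℚ m + ℕ→ℚ n))               ≡⟨ regroup (poch a m) (poch (a + ℕ→ℚ m) n) a (ℕ→ℚ m) (ℕ→ℚ n) ⟩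
  poch a m * (poch (a + ℕ→ℚ m) n * (a + ℕ→ℚ m + ℕ→ℚ n))               ∎
  where
  open ≡-Reasoning
  regroup : ∀ u v a x y → u * v * (a + (x + y)) ≡ u * (v * (a + x + y))
  regroup = solve-∀ ring

poch-front : ∀ a n → poch a (suc n) ≡ a * poch (a + 1ℚ) n
poch-front a n = trans (poch-+ a 1 n) (cong (_* poch (a + 1ℚ) n) (first a))
  where
  first : ∀ a → 1ℚ * (a + ℕ→ℚ 0) ≡ a
  first = solve-∀ ring

-- A polynomial in y², so a multiple of M in place of y affects it only modulo M².
squareProduct : ℚ → ℕ → ℚ
squareProduct y zero = 1ℚ
squareProduct y (suc m) = squareProduct y m * (y * y - (half + ℕ→ℚ m) * (half + ℕ→ℚ m))

-- The 2m factors run from y - m + ½ to y + m - ½, symmetrically about y; the pair y - (j + ½), y +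
-- (j + ½) is a difference of squares. Passing to m + 1 adds one factor at each end.
poch-centred : ∀ y m → poch (y + half - ℕ→ℚ m) (2 ℕ.* m) ≡ squareProduct y m
poch-centred y zero = refl
poch-centred y (suc m) = begin
  poch (y + half - ℕ→ℚ (suc m)) (2 ℕ.* suc m)
    ≡⟨ cong₂ (λ u N → poch (y + half - u) N) (ℕ→ℚ-suc m) (ℕ.*-suc 2 m) ⟩
  poch a (suc (2 ℕ.* m)) * (a + ℕ→ℚ (suc (2 ℕ.* m)))
    ≡⟨ cong₂ _*_ (poch-front a (2 ℕ.* m)) (cong (λ u → a + u) (trans (ℕ→ℚ-suc (2 ℕ.* m)) (cong (_+ 1ℚ) (ℕ→ℚ-* 2 m)))) ⟩
  a * poch (a + 1ℚ) (2 ℕ.* m) * (a + (ℕ→ℚ 2 * x + 1ℚ))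
    ≡⟨ cong (λ u → a * poch u (2 ℕ.* m) * (a + (ℕ→ℚ 2 * x + 1ℚ))) (shift y x) ⟩
  a * poch (y + half - x) (2 ℕ.* m) * (a + (ℕ→ℚ 2 * x + 1ℚ))
    ≡⟨ cong (λ u → a * u * (a + (ℕ→ℚ 2 * x + 1ℚ))) (poch-centred y m) ⟩
  a * squareProduct y m * (a + (ℕ→ℚ 2 * x + 1ℚ))
    ≡⟨ regroup y x (squareProduct y m) ⟩
  squareProduct y m * (y * y - (half + x) * (half + x)) ∎
  where
  open ≡-Reasoning
  x = ℕ→ℚ m
  a = y + half - (x + 1ℚ)
  shift : ∀ y x → y + half - (x + 1ℚ) + 1ℚ ≡ y + half - x
  shift = solve-∀ ring
  regroup : ∀ y x w → (y + half - (x + 1ℚ)) * w * (y + half - (x + 1ℚ) + (ℕ→ℚ 2 * x + 1ℚ))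
                      ≡ w * (y * y - (half + x) * (half + x))
  regroup = solve-∀ ring

-- The duplication formula for (2m)!: its odd factors 2j + 1 = 2 (½ + j) give 2^m (½)_m, and its
-- even factors 2j + 2 = 2 (1 + j) give 2^m m!.
poch-duplication : ∀ m → poch 1ℚ (2 ℕ.* m) ≡ ℕ→ℚ 4 ^ℚ m * poch 1ℚ m * P m
poch-duplication zero = refl
poch-duplication (suc m) = begin
  poch 1ℚ (2 ℕ.* suc m)
    ≡⟨ cong (poch 1ℚ) (ℕ.*-suc 2 m) ⟩
  poch 1ℚ (2 ℕ.* m) * (1ℚ + ℕ→ℚ (2 ℕ.* m)) * (1ℚ + ℕ→ℚ (suc (2 ℕ.* m)))
    ≡⟨ cong₂ (λ u v → poch 1ℚ (2 ℕ.* m) * (1ℚ + u) * (1ℚ + v)) (ℕ→ℚ-* 2 m)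
         (trans (ℕ→ℚ-suc (2 ℕ.* m)) (cong (_+ 1ℚ) (ℕ→ℚ-* 2 m))) ⟩
  poch 1ℚ (2 ℕ.* m) * (1ℚ + ℕ→ℚ 2 * x) * (1ℚ + (ℕ→ℚ 2 * x + 1ℚ))
    ≡⟨ cong (λ u → u * (1ℚ + ℕ→ℚ 2 * x) * (1ℚ + (ℕ→ℚ 2 * x + 1ℚ))) (poch-duplication m) ⟩
  ℕ→ℚ 4 ^ℚ m * poch 1ℚ m * P m * (1ℚ + ℕ→ℚ 2 * x) * (1ℚ + (ℕ→ℚ 2 * x + 1ℚ))
    ≡⟨ regroup (ℕ→ℚ 4 ^ℚ m) (poch 1ℚ m) (P m) x ⟩
  ℕ→ℚ 4 * ℕ→ℚ 4 ^ℚ m * (poch 1ℚ m * (1ℚ + x)) * (P m * (half + x)) ∎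
  where
  open ≡-Reasoning
  x = ℕ→ℚ m
  regroup : ∀ a b c x → a * b * c * (1ℚ + ℕ→ℚ 2 * x) * (1ℚ + (ℕ→ℚ 2 * x + 1ℚ))
                        ≡ ℕ→ℚ 4 * a * (b * (1ℚ + x)) * (c * (half + x))
  regroup = solve-∀ ring

product-of-ones : ∀ {a b} → a ≡ 1ℚ → b ≡ 1ℚ → a * b ≡ 1ℚ
product-of-ones refl refl = refl

invFact-inverse : ∀ n → invFact n * poch 1ℚ n ≡ 1ℚ
invFact-inverse zero = refl
invFact-inverse (suc n) = trans
  (regroup (invFact n) (recip n) (poch 1ℚ n) (ℕ→ℚ n)) (product-of-ones (invFact-inverse n) (recip-inverse n))
  where
  regroup : ∀ i r w x → i * r * (w * (1ℚ + x)) ≡ i * w * (r * (x + 1ℚ))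
  regroup = solve-∀ ring

invFact-falling : ∀ n → invFact n * falling (ℕ→ℚ n) n ≡ 1ℚ
invFact-falling zero = refl
invFact-falling (suc n) = begin
  invFact n * recip n * falling (ℕ→ℚ (suc n)) (suc n)   ≡⟨ cong (λ u → invFact n * recip n * falling u (suc n)) (ℕ→ℚ-suc n) ⟩
  invFact n * recip n * falling (x + 1ℚ) (suc n)        ≡⟨ cong (invFact n * recip n *_) (falling-suc x n) ⟩
  invFact n * recip n * ((x + 1ℚ) * falling x n)        ≡⟨ regroup (invFact n) (recip n) (falling x n) x ⟩
  invFact n * falling x n * (recip n * (x + 1ℚ))        ≡⟨ product-of-ones (invFact-falling n) (recip-inverse n) ⟩
  1ℚ                                                    ∎
  where
  open ≡-Reasoning
  x = ℕ→ℚ n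
  regroup : ∀ i r w x → i * r * ((x + 1ℚ) * w) ≡ i * w * (r * (x + 1ℚ))
  regroup = solve-∀ ring

invPoch-inverse : ∀ k → invPoch k * P k ≡ 1ℚ
invPoch-inverse zero = refl
invPoch-inverse (suc k) = trans
  (regroup (invPoch k) (invOdd k) (P k) (ℕ→ℚ k)) (product-of-ones (invPoch-inverse k) (invOdd-inverse k))
  where
  regroup : ∀ i r w x → i * r * (w * (half + x)) ≡ i * w * (r * (x + half))
  regroup = solve-∀ ring

-1^-square : ∀ n → -1^ n * -1^ n ≡ 1ℚ
-1^-square zero = refl
-1^-square (suc n) = trans (regroup (-1^ n)) (-1^-square n)
  where
  regroup : ∀ s → - 1ℚ * s * (- 1ℚ * s) ≡ s * s
  regroup = solve-∀ ring

1/16-inverse : ∀ n → 1/16 ^ℚ n * (ℕ→ℚ 4 ^ℚ n * ℕ→ℚ 4 ^ℚ n) ≡ 1ℚ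
1/16-inverse zero = refl
1/16-inverse (suc n) = trans (regroup (1/16 ^ℚ n) (ℕ→ℚ 4 ^ℚ n)) (1/16-inverse n)
  where
  regroup : ∀ e w → 1/16 * e * (ℕ→ℚ 4 * w * (ℕ→ℚ 4 * w)) ≡ e * (w * w)
  regroup = solve-∀ ring

falling-vanishes : ∀ {n k} → n ℕ.< k → falling (ℕ→ℚ n) k ≡ 0ℚ
falling-vanishes {n} {suc k} (ℕ.s≤s n≤k) with ℕ.m≤n⇒m<n∨m≡n n≤k
... | inj₁ n<k = trans (cong (_* (ℕ→ℚ n - ℕ→ℚ k)) (falling-vanishes n<k)) (*-zeroˡ (ℕ→ℚ n - ℕ→ℚ k))
... | inj₂ refl = trans (cong (falling (ℕ→ℚ n) n *_) (+-inverseʳ (ℕ→ℚ n))) (*-zeroʳ (falling (ℕ→ℚ n) n))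

sumTo-+ : ∀ M N f → sumTo (M ℕ.+ N) f ≡ sumTo M f + sumTo N (λ n → f (M ℕ.+ n))
sumTo-+ M zero f = trans (cong (λ z → sumTo z f) (ℕ.+-identityʳ M)) (sym (+-identityʳ (sumTo M f)))
sumTo-+ M (suc N) f = begin
  sumTo (M ℕ.+ suc N) f                                            ≡⟨ cong (λ z → sumTo z f) (ℕ.+-suc M N) ⟩
  sumTo (M ℕ.+ N) f + f (M ℕ.+ N)                                  ≡⟨ cong (_+ f (M ℕ.+ N)) (sumTo-+ M N f) ⟩
  sumTo M f + sumTo N (λ n → f (M ℕ.+ n)) + f (M ℕ.+ N)            ≡⟨ +-assoc (sumTo M f) (sumTo N (λ n → f (M ℕ.+ n))) (f (M ℕ.+ N)) ⟩
  sumTo M f + (sumTo N (λ n → f (M ℕ.+ n)) + f (M ℕ.+ N))          ∎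
  where open ≡-Reasoning

-- The linear factor 18m + 3 = 6 (3m + ½) extends (½)_{3m} to (½)_{3m+1}, which splits into
-- (½)_{m+1} and 2m factors centred at 2m + 1. Then 6 (m + ½) = 3 (2m + 1), the two copies of (½)_m
-- cancel `invPoch m` squared, and `falling` cancels one of the three 1/m!.
F-diagonal : ∀ m → F m m ≡
  ℕ→ℚ 3 * (ℕ→ℚ 2 * ℕ→ℚ m + 1ℚ) * (invFact m * invFact m * 1/16 ^ℚ m * squareProduct (ℕ→ℚ 2 * ℕ→ℚ m + 1ℚ) m)
F-diagonal m = begin
  F m m
    ≡⟨ regroup₁ x s (P m) e i q (P (2 ℕ.* m ℕ.+ m)) f ⟩
  ℕ→ℚ 6 * (s * s * (q * q) * (i * f) * (i * i * e)) * P m * (P (2 ℕ.* m ℕ.+ m) * (half + (ℕ→ℚ 2 * x + x)))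
    ≡⟨ cong (λ u → ℕ→ℚ 6 * (s * s * (q * q) * (i * f) * (i * i * e)) * P m * (P (2 ℕ.* m ℕ.+ m) * (half + u))) (ℕ→ℚ-2n+k m m) ⟨
  ℕ→ℚ 6 * (s * s * (q * q) * (i * f) * (i * i * e)) * P m * P (suc (2 ℕ.* m ℕ.+ m))
    ≡⟨ cong (λ u → ℕ→ℚ 6 * (s * s * (q * q) * (i * f) * (i * i * e)) * P m * u) P-split ⟩
  ℕ→ℚ 6 * (s * s * (q * q) * (i * f) * (i * i * e)) * P m * (P m * (half + x) * w)
    ≡⟨ regroup₂ s q (i * f) (i * i * e) (P m) x w ⟩
  ℕ→ℚ 3 * (ℕ→ℚ 2 * x + 1ℚ) * (i * i * e * w) * (s * s * (q * P m * (q * P m)) * (i * f))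
    ≡⟨ cong (ℕ→ℚ 3 * (ℕ→ℚ 2 * x + 1ℚ) * (i * i * e * w) *_)
         (product-of-ones (product-of-ones (-1^-square m) (product-of-ones (invPoch-inverse m) (invPoch-inverse m))) (invFact-falling m)) ⟩
  ℕ→ℚ 3 * (ℕ→ℚ 2 * x + 1ℚ) * (i * i * e * w) * 1ℚ
    ≡⟨ *-identityʳ (ℕ→ℚ 3 * (ℕ→ℚ 2 * x + 1ℚ) * (i * i * e * w)) ⟩
  ℕ→ℚ 3 * (ℕ→ℚ 2 * x + 1ℚ) * (i * i * e * w) ∎
  where
  open ≡-Reasoning
  x = ℕ→ℚ m
  s = -1^ m
  e = 1/16 ^ℚ m
  i = invFact m
  q = invPoch m
  f = falling x m
  w = squareProduct (ℕ→ℚ 2 * x + 1ℚ) m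
  shift : ∀ x → half + (x + 1ℚ) ≡ ℕ→ℚ 2 * x + 1ℚ + half - x
  shift = solve-∀ ring
  P-split : P (suc (2 ℕ.* m ℕ.+ m)) ≡ P m * (half + x) * w
  P-split = begin
    P (suc (2 ℕ.* m ℕ.+ m))                            ≡⟨ cong (λ z → P (suc z)) (ℕ.+-comm (2 ℕ.* m) m) ⟩
    P (suc m ℕ.+ 2 ℕ.* m)                              ≡⟨ poch-+ half (suc m) (2 ℕ.* m) ⟩
    P (suc m) * poch (half + ℕ→ℚ (suc m)) (2 ℕ.* m)    ≡⟨ cong (λ u → P (suc m) * poch u (2 ℕ.* m)) (trans (cong (λ u → half + u) (ℕ→ℚ-suc m)) (shift x)) ⟩
    P (suc m) * poch (ℕ→ℚ 2 * x + 1ℚ + half - x) (2 ℕ.* m)   ≡⟨ cong (P (suc m) *_) (poch-centred (ℕ→ℚ 2 * x + 1ℚ) m) ⟩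
    P (suc m) * w                                      ∎
  regroup₁ : ∀ x s p e i q p₃ f →
    (ℕ→ℚ 20 * x - ℕ→ℚ 2 * x + ℕ→ℚ 3) * ((s * p * e * (i * i * i)) * (s * (q * q)) * p₃ * f)
    ≡ ℕ→ℚ 6 * (s * s * (q * q) * (i * f) * (i * i * e)) * p * (p₃ * (half + (ℕ→ℚ 2 * x + x)))
  regroup₁ = solve-∀ ring
  regroup₂ : ∀ s q f e p x w →
    ℕ→ℚ 6 * (s * s * (q * q) * f * e) * p * (p * (half + x) * w)
    ≡ ℕ→ℚ 3 * (ℕ→ℚ 2 * x + 1ℚ) * (e * w) * (s * s * (q * p * (q * p)) * f)
  regroup₂ = solve-∀ ring

-- Rationals integral at p, and divisibility among them.

record Integral (p : ℕ) (x : ℚ) : Set where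
  constructor integral
  field
    denominator-coprime : Coprime (↧ₙ x) p

module _ {p : ℕ} where

  private
    -- Here `d` is an unreduced denominator and `i` the factor lost in reduction: the reduced
    -- denominator divides `d` and inherits coprimality to p.
    denominator-∣ : ∀ {x i d} → ↧ x ℤ.* i ≡ + d → Coprime d p → Integral p x
    denominator-∣ {x} {i} {d} eq d⊥p = integral λ (e∣x , e∣p) → d⊥p (∣-trans e∣x x∣d , e∣p)
      where
      x∣d : ↧ₙ x ∣ d
      x∣d = divides ℤ.∣ i ∣
        (trans (sym (cong ℤ.∣_∣ eq)) (trans (ℤ.abs-* (↧ x) i) (ℕ.*-comm (↧ₙ x) ℤ.∣ i ∣)))

  integral-/ : ∀ i n .{{_ : ℕ.NonZero n}} → Coprime n p → Integral p (i / n)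
  integral-/ i n = denominator-∣ (↧-/ i n)

  integral-ℕ : ∀ n → Integral p (ℕ→ℚ n)
  integral-ℕ n = integral-/ (+ n) 1 (1-coprimeTo p)

  integral-+ : ∀ {x y} → Integral p x → Integral p y → Integral p (x + y)
  integral-+ {x@record{}} {y@record{}} (integral x⊥p) (integral y⊥p) =
    denominator-∣ (↧-+ x y) (coprime-* {↧ₙ x} {↧ₙ y} x⊥p y⊥p)

  integral-* : ∀ {x y} → Integral p x → Integral p y → Integral p (x * y)
  integral-* {x@record{}} {y@record{}} (integral x⊥p) (integral y⊥p) =
    denominator-∣ (↧-* x y) (coprime-* {↧ₙ x} {↧ₙ y} x⊥p y⊥p)

  integral-neg : ∀ {x} → Integral p x → Integral p (- x)
  integral-neg {x} (integral x⊥p) = integral (subst (λ d → Coprime d p) (sym (ℤ.+-injective (↧-neg x))) x⊥p)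

  integral-- : ∀ {x y} → Integral p x → Integral p y → Integral p (x - y)
  integral-- x⊥p y⊥p = integral-+ x⊥p (integral-neg y⊥p)

  integral-^ : ∀ {x} n → Integral p x → Integral p (x ^ℚ n)
  integral-^ zero x⊥p = integral-ℕ 1
  integral-^ (suc n) x⊥p = integral-* x⊥p (integral-^ n x⊥p)

  integral-poch : ∀ {a} n → Integral p a → Integral p (poch a n)
  integral-poch zero a⊥p = integral-ℕ 1
  integral-poch (suc n) a⊥p = integral-* (integral-poch n a⊥p) (integral-+ a⊥p (integral-ℕ n))

  integral-falling : ∀ {x} n → Integral p x → Integral p (falling x n)
  integral-falling zero x⊥p = integral-ℕ 1
  integral-falling (suc n) x⊥p = integral-* (integral-falling n x⊥p) (integral-- x⊥p (integral-ℕ n))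

-- Divisibility in the ring behind `CongMod`. The modulus is arbitrary, so that p, p² and p³ are
-- handled alike and multiply through `multiple-*`.
record Multiple (p : ℕ) (M x : ℚ) : Set where
  constructor multiple
  field
    quotient : ℚ
    equation : x ≡ M * quotient
    quotient-integral : Integral p quotient

Multiple⇒CongMod : ∀ {p M} a b → Multiple p M (a - b) → CongMod p M a b
Multiple⇒CongMod a b (multiple c eq (integral c⊥p)) = c , eq , c⊥p

multiple-refl : ∀ {p} M → Multiple p M M
multiple-refl M = multiple 1ℚ (sym (*-identityʳ M)) (integral-ℕ 1)

module _ {p : ℕ} {M : ℚ} where

  multiple-0 : ∀ {x} → x ≡ 0ℚ → Multiple p M x
  multiple-0 x≡0 = multiple 0ℚ (trans x≡0 (sym (*-zeroʳ M))) (integral-ℕ 0)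

  multiple-+ : ∀ {x y} → Multiple p M x → Multiple p M y → Multiple p M (x + y)
  multiple-+ (multiple c eq c⊥p) (multiple d eq′ d⊥p) =
    multiple (c + d) (trans (cong₂ _+_ eq eq′) (sym (*-distribˡ-+ M c d))) (integral-+ c⊥p d⊥p)

  multiple-*ʳ : ∀ {x y} → Multiple p M x → Integral p y → Multiple p M (x * y)
  multiple-*ʳ {y = y} (multiple c eq c⊥p) y⊥p =
    multiple (c * y) (trans (cong (_* y) eq) (*-assoc M c y)) (integral-* c⊥p y⊥p)

  multiple-*ˡ : ∀ {x y} → Integral p x → Multiple p M y → Multiple p M (x * y)
  multiple-*ˡ {x} {y} x⊥p M∣y = subst (Multiple p M) (*-comm y x) (multiple-*ʳ M∣y x⊥p)

  multiple-sum : ∀ N {f} → (∀ n → n ℕ.< N → Multiple p M (f n)) → Multiple p M (sumTo N f)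
  multiple-sum zero M∣f = multiple-0 refl
  multiple-sum (suc N) M∣f =
    multiple-+ (multiple-sum N λ n n<N → M∣f n (ℕ.m<n⇒m<1+n n<N)) (M∣f N (ℕ.n<1+n N))

  -- Splitting just after the factor a + j leaves p-integral products on either side of it.
  multiple-poch : ∀ {a N} j → j ℕ.< N → Integral p a → Multiple p M (a + ℕ→ℚ j) → Multiple p M (poch a N)
  multiple-poch {a} {N} j j<N a⊥p M∣a+j = subst (λ n → Multiple p M (poch a n)) (ℕ.m+[n∸m]≡n j<N)
    (subst (Multiple p M) (sym (poch-+ a (suc j) (N ℕ.∸ suc j)))
      (multiple-*ʳ (multiple-*ˡ (integral-poch j a⊥p) M∣a+j)
        (integral-poch (N ℕ.∸ suc j) (integral-+ a⊥p (integral-ℕ (suc j))))))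

multiple-* : ∀ {p M N x y} → Multiple p M x → Multiple p N y → Multiple p (M * N) (x * y)
multiple-* {M = M} {N} (multiple c eq c⊥p) (multiple d eq′ d⊥p) =
  multiple (c * d) (trans (cong₂ _*_ eq eq′) (interchange M c N d)) (integral-* c⊥p d⊥p)
  where
  interchange : ∀ a b c d → a * b * (c * d) ≡ a * c * (b * d)
  interchange = solve-∀ ring

-- Modulo (M u)² every factor y² − (j + ½)² with y = M u becomes −(j + ½)².
squareProduct-mod : ∀ {p M y} m → Integral p half → Integral p y → Multiple p M y →
  Multiple p (M * M) (squareProduct y m - -1^ m * (P m * P m))
squareProduct-mod zero _ _ _ = multiple-0 refl
squareProduct-mod {p} {M} {y} (suc m) h⊥p y⊥p M∣y =
  subst (Multiple p (M * M)) (sym (regroup (squareProduct y m) y z (-1^ m) (P m)))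
    (multiple-+
      (multiple-*ʳ (squareProduct-mod m h⊥p y⊥p M∣y) (integral-- (integral-* y⊥p y⊥p) (integral-* z⊥p z⊥p)))
      (multiple-*ˡ (integral-* (integral-^ m (integral-neg (integral-ℕ 1))) (integral-* Pm⊥p Pm⊥p)) (multiple-* M∣y M∣y)))
  where
  z = half + ℕ→ℚ m
  z⊥p = integral-+ h⊥p (integral-ℕ m)
  Pm⊥p = integral-poch m h⊥p
  regroup : ∀ w y z s p → w * (y * y - z * z) - - 1ℚ * s * (p * z * (p * z))
    ≡ (w - s * (p * p)) * (y * y - z * z) + s * (p * p) * (y * y)
  regroup = solve-∀ ring

-- The congruence for a prime p = 2m + 1.

module OddPrime (m : ℕ) (p-prime : Prime (suc (2 ℕ.* m))) (2<p : 2 ℕ.< suc (2 ℕ.* m)) where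

  p : ℕ
  p = suc (2 ℕ.* m)

  π : ℚ
  π = ℕ→ℚ p

  π≡2m+1 : π ≡ ℕ→ℚ 2 * ℕ→ℚ m + 1ℚ
  π≡2m+1 = trans (ℕ→ℚ-suc (2 ℕ.* m)) (cong (_+ 1ℚ) (ℕ→ℚ-* 2 m))

  integral-1/ : ∀ {n} .{{_ : ℕ.NonZero n}} → n ℕ.< p → Integral p (+ 1 / n)
  integral-1/ {n} n<p = integral-/ (+ 1) n (Coprimality.sym (prime⇒coprime p-prime n<p))

  integral-half : Integral p half
  integral-half = integral-1/ 2<p

  integral-1/16 : Integral p 1/16
  integral-1/16 = integral-* (integral-* integral-half integral-half) (integral-* integral-half integral-half)

  integral--1^ : ∀ n → Integral p (-1^ n)
  integral--1^ n = integral-^ n (integral-neg (integral-ℕ 1))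

  integral-invFact : ∀ n → n ℕ.< p → Integral p (invFact n)
  integral-invFact zero n<p = integral-ℕ 1
  integral-invFact (suc n) n<p = integral-* (integral-invFact n (ℕ.<-trans (ℕ.n<1+n n) n<p)) (integral-1/ n<p)

  -- The denominator 2k + 1 stays below p. The bound is sharp: at k = m it is p itself, which is why
  -- the descent in k stops at m.
  integral-invOdd : ∀ {k} → k ℕ.< m → Integral p (invOdd k)
  integral-invOdd k<m = integral-* (integral-ℕ 2) (integral-1/ (ℕ.s<s (ℕ.*-monoʳ-< 2 k<m)))

  integral-invPoch : ∀ k → k ℕ.≤ m → Integral p (invPoch k)
  integral-invPoch zero k≤m = integral-ℕ 1
  integral-invPoch (suc k) k<m = integral-* (integral-invPoch k (ℕ.<⇒≤ k<m)) (integral-invOdd k<m)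

  integral-P : ∀ n → Integral p (P n)
  integral-P n = integral-poch n integral-half

  -- The factor with index m is m + ½ = p/2.
  multiple-P : ∀ {N} → m ℕ.< N → Multiple p π (P N)
  multiple-P m<N = multiple-poch m m<N integral-half
    (multiple half (trans (shift (ℕ→ℚ m)) (cong (_* half) (sym π≡2m+1))) integral-half)
    where
    shift : ∀ x → half + x ≡ (ℕ→ℚ 2 * x + 1ℚ) * half
    shift = solve-∀ ring

  -- Beyond p/2 the next multiple of p among the factors is 3p/2.
  multiple²-P : ∀ {N} → suc m ℕ.+ p ℕ.≤ N → Multiple p (π * π) (P N)
  multiple²-P {N} m+p≤N = subst (λ n → Multiple p (π * π) (P n)) (ℕ.m+[n∸m]≡n (ℕ.m+n≤o⇒m≤o (suc m) m+p≤N))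
    (subst (Multiple p (π * π)) (sym (poch-+ half (suc m) (N ℕ.∸ suc m)))
      (multiple-* (multiple-P (ℕ.n<1+n m))
        (multiple-poch (2 ℕ.* m) (ℕ.m+n≤o⇒m≤o∸n p (subst (ℕ._≤ N) (ℕ.+-comm (suc m) p) m+p≤N)) (integral-+ integral-half (integral-ℕ (suc m)))
          (multiple (ℕ→ℚ 3 * half) 3p/2 (integral-* (integral-ℕ 3) integral-half)))))
    where
    open ≡-Reasoning
    shift : ∀ x → half + (x + 1ℚ) + ℕ→ℚ 2 * x ≡ (ℕ→ℚ 2 * x + 1ℚ) * (ℕ→ℚ 3 * half)
    shift = solve-∀ ring
    3p/2 : half + ℕ→ℚ (suc m) + ℕ→ℚ (2 ℕ.* m) ≡ π * (ℕ→ℚ 3 * half)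
    3p/2 = begin
      half + ℕ→ℚ (suc m) + ℕ→ℚ (2 ℕ.* m)              ≡⟨ cong₂ (λ u v → half + u + v) (ℕ→ℚ-suc m) (ℕ→ℚ-* 2 m) ⟩
      half + (ℕ→ℚ m + 1ℚ) + ℕ→ℚ 2 * ℕ→ℚ m             ≡⟨ shift (ℕ→ℚ m) ⟩
      (ℕ→ℚ 2 * ℕ→ℚ m + 1ℚ) * (ℕ→ℚ 3 * half)           ≡⟨ cong (_* (ℕ→ℚ 3 * half)) π≡2m+1 ⟨
      π * (ℕ→ℚ 3 * half)                              ∎

  π³ : ℚ
  π³ = π * (π * π)

  -- The three factors p in p!³ are cancelled: two by the n² in `G`, the third by the leading factor
  -- of p (p - 1) ⋯ (p - k), which is `falling` completed by n - k. What remains is p-integral,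
  -- while (½)_p contributes p and (½)_{2p+k} contributes p².
  multiple-G : ∀ {k} → k ℕ.< m → Multiple p π³ (G p k)
  multiple-G {k} k<m = subst (Multiple p π³) (sym G-factored)
    (multiple-*ˡ (integral-* (integral-neg
        (integral-* (integral-* (integral-* (integral-* (integral-ℕ 32) (integral-* r⊥p r⊥p))
            (integral-* (integral-* (integral--1^ p) (integral-^ p integral-1/16))
              (integral-* (integral--1^ k) (integral-* q⊥p q⊥p))))
          (integral-* (integral-* i⊥p i⊥p) i⊥p))
        (integral-falling k (integral-ℕ (2 ℕ.* m)))))
      (integral-ℕ 1))
    (multiple-* (multiple-P (ℕ.s≤s (ℕ.m≤m+n m (m ℕ.+ 0)))) (multiple²-P bound)))
    where
    open ≡-Reasoning
    z y r s e b i t f P₂ : ℚ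
    z = ℕ→ℚ (2 ℕ.* m)
    y = ℕ→ℚ k
    r = invOdd k
    s = -1^ p
    e = 1/16 ^ℚ p
    b = -1^ k * (invPoch k * invPoch k)
    i = invFact (2 ℕ.* m)
    t = recip (2 ℕ.* m)
    f = falling z k
    P₂ = P (2 ℕ.* p ℕ.+ k)
    i⊥p = integral-invFact (2 ℕ.* m) (ℕ.n<1+n (2 ℕ.* m))
    q⊥p = integral-invPoch k (ℕ.<⇒≤ k<m)
    r⊥p = integral-invOdd k<m
    bound : suc m ℕ.+ p ℕ.≤ 2 ℕ.* p ℕ.+ k
    bound = ℕ.≤-trans (ℕ.+-mono-≤ (ℕ.s≤s (ℕ.m≤m+n m (m ℕ.+ 0))) (ℕ.m≤m+n p 0)) (ℕ.m≤m+n (2 ℕ.* p) k)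
    regroup₁ : ∀ x y r s pp e i t b p₂ g →
      - (ℕ→ℚ 32 * (x * x) * (x - y) * (r * r) * ((s * pp * e * (i * t * (i * t) * (i * t))) * b * p₂ * g))
      ≡ - (ℕ→ℚ 32 * (r * r) * (s * e * b) * (i * i * i) * (t * x * (t * x) * t * (g * (x - y)))) * (pp * p₂)
    regroup₁ = solve-∀ ring
    regroup₂ : ∀ a t x f c → - (a * (t * x * (t * x) * t * (x * f))) * c ≡ - (a * f) * (t * x * (t * x) * (t * x)) * c
    regroup₂ = solve-∀ ring
    G-factored : G p k ≡ - (ℕ→ℚ 32 * (r * r) * (s * e * b) * cube i * f) * 1ℚ * (P p * P₂)
    G-factored = begin
      G p k
        ≡⟨ cong (λ x → - (ℕ→ℚ 32 * (x * x) * (x - y) * (r * r) * ((s * P p * e * cube (i * t)) * b * P₂ * falling x k)))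
             (ℕ→ℚ-suc (2 ℕ.* m)) ⟩
      - (ℕ→ℚ 32 * ((z + 1ℚ) * (z + 1ℚ)) * (z + 1ℚ - y) * (r * r)
          * ((s * P p * e * cube (i * t)) * b * P₂ * falling (z + 1ℚ) k))
        ≡⟨ regroup₁ (z + 1ℚ) y r s (P p) e i t b P₂ (falling (z + 1ℚ) k) ⟩
      - (ℕ→ℚ 32 * (r * r) * (s * e * b) * cube i * (t * (z + 1ℚ) * (t * (z + 1ℚ)) * t * falling (z + 1ℚ) (suc k))) * (P p * P₂)
        ≡⟨ cong (λ u → - (ℕ→ℚ 32 * (r * r) * (s * e * b) * cube i * (t * (z + 1ℚ) * (t * (z + 1ℚ)) * t * u)) * (P p * P₂))
             (falling-suc z k) ⟩
      - (ℕ→ℚ 32 * (r * r) * (s * e * b) * cube i * (t * (z + 1ℚ) * (t * (z + 1ℚ)) * t * ((z + 1ℚ) * f))) * (P p * P₂)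
        ≡⟨ regroup₂ (ℕ→ℚ 32 * (r * r) * (s * e * b) * cube i) t (z + 1ℚ) f (P p * P₂) ⟩
      - (ℕ→ℚ 32 * (r * r) * (s * e * b) * cube i * f) * cube (t * (z + 1ℚ)) * (P p * P₂)
        ≡⟨ cong (λ u → - (ℕ→ℚ 32 * (r * r) * (s * e * b) * cube i * f) * cube u * (P p * P₂)) (recip-inverse (2 ℕ.* m)) ⟩
      - (ℕ→ℚ 32 * (r * r) * (s * e * b) * cube i * f) * 1ℚ * (P p * P₂) ∎

  sum-F : ℕ → ℚ
  sum-F k = sumTo p (λ n → F n k)

  telescope : ∀ a b c → (a - b) + (b - c) ≡ a - c
  telescope = solve-∀ ring

  -- By `sum-F-step`, passing from k to k + 1 changes the sum by `G p k`, a multiple of p³ as long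
  -- as k < m.
  sum-term≡sum-F : ∀ k → k ℕ.≤ m → Multiple p π³ (sumTo p term - sum-F k)
  sum-term≡sum-F zero _ = multiple-0
    (trans (cong (_- sum-F 0) (sumTo-cong p term≡F)) (+-inverseʳ (sum-F 0)))
  sum-term≡sum-F (suc k) k<m = subst (Multiple p π³) (telescope (sumTo p term) (sum-F k) (sum-F (suc k)))
    (multiple-+ (sum-term≡sum-F k (ℕ.<⇒≤ k<m))
      (subst (Multiple p π³) (sym (sum-F-step p k)) (multiple-G k<m)))

  -- Since n < p, 1/n!³ is p-integral and all powers of p from (½)_n (½)_{2n+m} survive. The
  -- smallest case n = m + 1 meets the bound (m + 1) + p ≤ 2n + m with equality.
  multiple-F-above : ∀ {n} → m ℕ.< n → n ℕ.< p → Multiple p π³ (F n m)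
  multiple-F-above {n} m<n n<p = subst (Multiple p π³)
    (regroup (ℕ→ℚ 20 * ℕ→ℚ n - ℕ→ℚ 2 * ℕ→ℚ m + ℕ→ℚ 3) (-1^ n) (P n) (1/16 ^ℚ n) (cube (invFact n))
      (-1^ m * (invPoch m * invPoch m)) (P (2 ℕ.* n ℕ.+ m)) (falling (ℕ→ℚ n) m))
    (multiple-*ˡ
      (integral-* (integral-+ (integral-- (integral-* (integral-ℕ 20) (integral-ℕ n)) (integral-* (integral-ℕ 2) (integral-ℕ m))) (integral-ℕ 3))
        (integral-* (integral-* (integral-* (integral-* (integral--1^ n) (integral-^ n integral-1/16))
              (integral-* (integral-* i⊥p i⊥p) i⊥p))
            (integral-* (integral--1^ m) (integral-* q⊥p q⊥p)))
          (integral-falling m (integral-ℕ n))))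
      (multiple-* (multiple-P m<n) (multiple²-P bound)))
    where
    i⊥p = integral-invFact n n<p
    q⊥p = integral-invPoch m ℕ.≤-refl
    m+p : ∀ m → suc m ℕ.+ suc (2 ℕ.* m) ≡ 2 ℕ.* suc m ℕ.+ m
    m+p = ℕ-solve-∀
    bound : suc m ℕ.+ p ℕ.≤ 2 ℕ.* n ℕ.+ m
    bound = subst (ℕ._≤ 2 ℕ.* n ℕ.+ m) (sym (m+p m)) (ℕ.+-monoˡ-≤ m (ℕ.*-monoʳ-≤ 2 m<n))
    regroup : ∀ c s pn e i b p₂ f → c * (s * e * i * b * f) * (pn * p₂) ≡ c * ((s * pn * e * i) * b * p₂ * f)
    regroup = solve-∀ ring

  -- As p = (m + 1) + m, the range consists of m vanishing terms, the term n = m, and m terms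
  -- divisible by p³.
  sum-F≡F : Multiple p π³ (sum-F m - F m m)
  sum-F≡F = subst (Multiple p π³) (sym split)
    (multiple-+
      (multiple-sum m λ n n<m → multiple-0 (F-below n<m))
      (multiple-sum m λ n n<m → multiple-F-above (ℕ.m≤m+n (suc m) n) (subst (suc m ℕ.+ n ℕ.<_) (sym p≡) (ℕ.+-monoʳ-< (suc m) n<m))))
    where
    open ≡-Reasoning
    p≡ : p ≡ suc m ℕ.+ m
    p≡ = cong (λ z → suc (m ℕ.+ z)) (ℕ.+-identityʳ m)
    F-below : ∀ {n} → n ℕ.< m → F n m ≡ 0ℚ
    F-below {n} n<m = trans
      (cong (λ u → c * (a * u)) (falling-vanishes n<m)) (trans (cong (c *_) (*-zeroʳ a)) (*-zeroʳ c))
      where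
      c a : ℚ
      c = ℕ→ℚ 20 * ℕ→ℚ n - ℕ→ℚ 2 * ℕ→ℚ m + ℕ→ℚ 3
      a = (-1^ n * P n * 1/16 ^ℚ n * cube (invFact n)) * (-1^ m * (invPoch m * invPoch m)) * P (2 ℕ.* n ℕ.+ m)
    below above : ℚ
    below = sumTo m (λ n → F n m)
    above = sumTo m (λ n → F (suc m ℕ.+ n) m)
    cancel : ∀ a b c → a + b + c - b ≡ a + c
    cancel = solve-∀ ring
    split : sum-F m - F m m ≡ below + above
    split = begin
      sum-F m - F m m                          ≡⟨ cong (λ N → sumTo N (λ n → F n m) - F m m) p≡ ⟩
      sumTo (suc m ℕ.+ m) (λ n → F n m) - F m m   ≡⟨ cong (_- F m m) (sumTo-+ (suc m) m (λ n → F n m)) ⟩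
      below + F m m + above - F m m            ≡⟨ cancel below (F m m) above ⟩
      below + above                            ∎

  -- Morley's congruence modulo p²: both (2m)! and the product in F m m are squareProducts at a multiple of p.
  diagonal-mod : Multiple p (π * π) (invFact m * invFact m * 1/16 ^ℚ m * squareProduct π m - -1^ m)
  diagonal-mod = subst (Multiple p (π * π)) combination
    (multiple-+
      (multiple-*ˡ iie⊥p (squareProduct-mod m integral-half π⊥p (multiple-refl π)))
      (multiple-*ʳ P-mod (integral-neg (integral-* (integral-* (integral--1^ m) iie⊥p)
        (integral-+ (integral-* w⊥p M⊥p) (integral-* (integral--1^ m) (integral-P m)))))))
    where
    open ≡-Reasoning
    x s e i q w M W : ℚ
    x = ℕ→ℚ m
    s = -1^ m
    e = 1/16 ^ℚ m
    i = invFact m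
    q = invPoch m
    w = ℕ→ℚ 4 ^ℚ m
    M = poch 1ℚ m
    W = squareProduct π m
    π⊥p : Integral p π
    π⊥p = integral-ℕ p
    w⊥p = integral-^ m (integral-ℕ 4)
    M⊥p = integral-poch m (integral-ℕ 1)
    iie⊥p : Integral p (i * i * e)
    iie⊥p = integral-* (integral-* i⊥p i⊥p) (integral-^ m integral-1/16)
      where i⊥p = integral-invFact m (ℕ.s≤s (ℕ.m≤m+n m (m ℕ.+ 0)))
    shift : ∀ x → (ℕ→ℚ 2 * x + 1ℚ) * half + half - x ≡ 1ℚ
    shift = solve-∀ ring
    -- Centred at p/2, the run of 2m factors starts at p/2 + ½ - m = 1.
    [2m]! : squareProduct (π * half) m ≡ w * M * P m
    [2m]! = begin
      squareProduct (π * half) m                       ≡⟨ poch-centred (π * half) m ⟨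
      poch (π * half + half - x) (2 ℕ.* m)             ≡⟨ cong (λ u → poch u (2 ℕ.* m)) (trans (cong (λ u → u * half + half - x) π≡2m+1) (shift x)) ⟩
      poch 1ℚ (2 ℕ.* m)                                ≡⟨ poch-duplication m ⟩
      w * M * P m                                      ∎
    regroup : ∀ w M p s q → (w * M * p - s * (p * p)) * q ≡ (w * M - s * p) * (q * p)
    regroup = solve-∀ ring
    -- The congruence for (2m)! carries a common factor (½)_m, which has the p-integral inverse
    -- `invPoch m` and so cancels: 4^m m! ≡ (-1)^m (½)_m.
    P-mod : Multiple p (π * π) (w * M - s * P m)
    P-mod = subst (Multiple p (π * π))
      (trans (regroup w M (P m) s q)
        (trans (cong ((w * M - s * P m) *_) (invPoch-inverse m)) (*-identityʳ (w * M - s * P m))))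
      (multiple-*ʳ
        (subst (λ u → Multiple p (π * π) (u - s * (P m * P m))) [2m]!
          (squareProduct-mod m integral-half (integral-* π⊥p integral-half) (multiple-*ʳ (multiple-refl π) integral-half)))
        (integral-invPoch m ℕ.≤-refl))
    expand : ∀ i e W s p w M →
      i * i * e * (W - s * (p * p)) + (w * M - s * p) * - (s * (i * i * e) * (w * M + s * p))
      ≡ i * i * e * W - s * (i * M * (i * M) * (e * (w * w))) + i * i * e * s * (p * p) * (s * s - 1ℚ)
    expand = solve-∀ ring
    simplify : ∀ a s b → a - s * 1ℚ + b * (1ℚ - 1ℚ) ≡ a - s
    simplify = solve-∀ ring
    -- The cofactor of `P-mod` contains the conjugate w M + s (½)_m, so the product is a difference
    -- of squares. Adding it trades s (½)_m² for s (4^m m!)², and i² e = 1/(16^m m!²) turns the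
    -- latter into s.
    combination : i * i * e * (W - s * (P m * P m)) + (w * M - s * P m) * - (s * (i * i * e) * (w * M + s * P m))
                  ≡ i * i * e * W - s
    combination = begin
      i * i * e * (W - s * (P m * P m)) + (w * M - s * P m) * - (s * (i * i * e) * (w * M + s * P m))
        ≡⟨ expand i e W s (P m) w M ⟩
      i * i * e * W - s * (i * M * (i * M) * (e * (w * w))) + i * i * e * s * (P m * P m) * (s * s - 1ℚ)
        ≡⟨ cong₂ (λ u v → i * i * e * W - s * u + i * i * e * s * (P m * P m) * (v - 1ℚ))
             (product-of-ones (product-of-ones (invFact-inverse m) (invFact-inverse m)) (1/16-inverse m)) (-1^-square m) ⟩
      i * i * e * W - s * 1ℚ + i * i * e * s * (P m * P m) * (1ℚ - 1ℚ)
        ≡⟨ simplify (i * i * e * W) s (i * i * e * s * (P m * P m)) ⟩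
      i * i * e * W - s ∎

  -- The explicit factor p in `F-diagonal` lifts the congruence of `diagonal-mod` from p² to p³.
  F-diagonal-mod : Multiple p π³ (F m m - ℕ→ℚ 3 * -1^ m * π)
  F-diagonal-mod = subst (Multiple p π³) (sym (trans (cong (_- ℕ→ℚ 3 * -1^ m * π) diagonal) (regroup π R (-1^ m))))
    (multiple-* (multiple-refl π) (multiple-*ˡ (integral-ℕ 3) diagonal-mod))
    where
    R : ℚ
    R = invFact m * invFact m * 1/16 ^ℚ m * squareProduct π m
    diagonal : F m m ≡ ℕ→ℚ 3 * π * R
    diagonal = trans (F-diagonal m)
      (cong (λ u → ℕ→ℚ 3 * u * (invFact m * invFact m * 1/16 ^ℚ m * squareProduct u m)) (sym π≡2m+1))
    regroup : ∀ π R s → ℕ→ℚ 3 * π * R - ℕ→ℚ 3 * s * π ≡ π * (ℕ→ℚ 3 * (R - s))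
    regroup = solve-∀ ring

  supercongruence : CongMod p (π ^ℚ 3) (sumTo p term) (ℕ→ℚ 3 * -1^ m * π)
  supercongruence = Multiple⇒CongMod (sumTo p term) (ℕ→ℚ 3 * -1^ m * π)
    (subst₂ (Multiple p) (π³≡ π) (telescope (sumTo p term) (F m m) (ℕ→ℚ 3 * -1^ m * π))
      (multiple-+
        (subst (Multiple p π³) (telescope (sumTo p term) (sum-F m) (F m m))
          (multiple-+ (sum-term≡sum-F m ℕ.≤-refl) sum-F≡F))
        F-diagonal-mod))
    where
    π³≡ : ∀ x → x * (x * x) ≡ x * (x * (x * 1ℚ))
    π³≡ = solve-∀ ring

-- Writing a prime above 2 as 2m + 1.

even⊎odd : ∀ n → (∃ λ m → n ≡ 2 ℕ.* m) ⊎ (∃ λ m → n ≡ suc (2 ℕ.* m))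
even⊎odd zero = inj₁ (0 , refl)
even⊎odd (suc n) with even⊎odd n
... | inj₁ (m , refl) = inj₂ (m , refl)
... | inj₂ (m , refl) = inj₁ (suc m , sym (ℕ.*-suc 2 m))

-- An even p has the divisor 2, which irreducibility forces to be 1 or p.
odd-prime : ∀ {p} → Prime p → p > 2 → ∃ λ m → p ≡ suc (2 ℕ.* m)
odd-prime {p} p-prime p>2 with even⊎odd p
... | inj₂ odd = odd
... | inj₁ (m , refl) with prime⇒irreducible p-prime (m∣m*n m)
...   | inj₁ ()
...   | inj₂ 2≡p = contradiction 2≡p (ℕ.<⇒≢ p>2)

theorem3 : (p : ℕ) → Prime p → p > 2 →
    CongMod p (ℕ→ℚ p ^ℚ 3)
    (sumTo p term)
    (ℕ→ℚ 3 * ((ℚ.- 1ℚ) ^ℚ ⌊ (p ∸ 1) /2⌋) * ℕ→ℚ p)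
theorem3 p p-prime p>2 with odd-prime p-prime p>2
... | m , refl = subst (λ h → CongMod p (ℕ→ℚ p ^ℚ 3) (sumTo p term) (ℕ→ℚ 3 * -1^ h * ℕ→ℚ p))
  -- With p = 2m + 1, `p ∸ 1` unfolds to `m + (m + 0)`, whose half is m.
  (trans (ℕ.n≡⌊n+n/2⌋ m) (cong (λ z → ⌊ m ℕ.+ z /2⌋) (sym (ℕ.+-identityʳ m))))
  (OddPrime.supercongruence m p-prime p>2)
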